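{- Every vertebrate graph is 1-guardable.
   Context: Cops and robber game on a finite simple connected graph $G$: cops are placed on vertices, then the robber; players alternate moves, each cop (resp. the robber) either staying or moving to an adjacent vertex; the robber is captured when a cop occupies its vertex. An induced subgraph $H$ of $G$ is isometric if $d_H(u,v)=d_G(u,v)$ for all $u,v\in V(H)$. One cop guards $H$ in $G$ if, after finitely many moves, the cop can move within $H$ so that whenever the robber moves into $H$ at some round $t$, it is captured at round $t+1$. A graph $H$ is 1-guardable if one cop can guard $H$ in every graph $G$ containing $H$ as an isometric subgraph. Notation: $d$ is graph distance, $N(x)$ the neighbourhood, $N[x]=N(x)\cup\{x\}$; for $d(c,x)\ge 2$, $N(c,x)=\{v\in N(c): d(c,x)=1+d(v,x)\}$ and $N_B(c,x)=N(c,x)\cap V(B)$. A block graph is a connected graph all of whose blocks (maximal 2-connected subgraphs) are complete; an extended block graph is obtained from a block graph by replacing each cut vertex by a clique, each clique vertex joined to all neighbours of the cut vertex. A simple connected graph $H$ is vertebrate if it has an induced subgraph $B$ that is an extended block graph such that for all $c\in V(B)$, $x\in V(H)$ with $d(c,x)\ge 2$ there is $c'\in N_B(c,x)$ with $N[c']\supseteq N[v]$ for all $v\in N(c,x)$ (distances and neighbourhoods taken in $H$). -}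

module Defs where

open import Data.Nat using (ℕ; zero; suc; _≤_; _<_)
open import Data.Fin using (Fin; toℕ)
open import Data.Fin.Subset using (Subset; _∈_; _⊆_; Nonempty)
open import Data.Bool using (Bool; true; false)
open import Data.Product using (Σ; ∃; _×_; _,_; proj₁; proj₂)
open import Data.Sum using (_⊎_)
open import Data.Unit using (⊤)
open import Relation.Nullary using (¬_)
open import Relation.Binary.PropositionalEquality using (_≡_; _≢_)
open import Function.Definitions using (Injective)

record Graph : Set where
  field
    n          : ℕ
    adj        : Fin n → Fin n → Bool
    adj-sym    : ∀ u v → adj u v ≡ adj v u
    adj-irrefl : ∀ u → adj u u ≡ false

V : Graph → Set
V G = Fin (Graph.n G)

Adj : (G : Graph) → V G → V G → Set
Adj G u v = Graph.adj G u v ≡ true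

ClosedNbr : (G : Graph) → V G → V G → Set
ClosedNbr G v w = w ≡ v ⊎ Adj G v w

data WalkP (G : Graph) (P : V G → Set) : V G → V G → ℕ → Set where
  here : ∀ {u} → P u → WalkP G P u u 0
  step : ∀ {u w v k} → P u → Adj G u w → WalkP G P w v k → WalkP G P u v (suc k)

Walk : (G : Graph) → V G → V G → ℕ → Set
Walk G = WalkP G (λ _ → ⊤)

Dist : (G : Graph) → V G → V G → ℕ → Set
Dist G u v k = Walk G u v k × (∀ m → Walk G u v m → k ≤ m)

ConnectedP : (G : Graph) → (V G → Set) → Set
ConnectedP G P = ∀ u v → P u → P v → ∃ λ k → WalkP G P u v k

Connected : Graph → Set
Connected G = (1 ≤ Graph.n G) × ConnectedP G (λ _ → ⊤)

ConnectedIn : (G : Graph) → Subset (Graph.n G) → Set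
ConnectedIn G S = ConnectedP G (λ u → u ∈ S)

NoCutIn : (G : Graph) → Subset (Graph.n G) → Set
NoCutIn G S = ∀ v → v ∈ S → ConnectedP G (λ u → u ∈ S × u ≢ v)

IsBlock : (G : Graph) → Subset (Graph.n G) → Set
IsBlock G S =
  Nonempty S × ConnectedIn G S × NoCutIn G S ×
  (∀ T → S ⊆ T → ConnectedIn G T → NoCutIn G T → T ⊆ S)

IsClique : (G : Graph) → Subset (Graph.n G) → Set
IsClique G S = ∀ u v → u ∈ S → v ∈ S → u ≢ v → Adj G u v

IsBlockGraph : Graph → Set
IsBlockGraph G = Connected G × (∀ S → IsBlock G S → IsClique G S)

IsCutVertex : (G : Graph) → V G → Set
IsCutVertex G v = ¬ ConnectedP G (λ u → u ≢ v)

-- B arises from a block graph K by replacing each cut vertex k of K by a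
-- (nonempty) clique φ⁻¹(k), each clique vertex joined to all (copies of)
-- neighbours of k; non-cut vertices are kept as single vertices.
IsExtendedBlockGraph : Graph → Set
IsExtendedBlockGraph B =
  Σ Graph λ K → Σ (V B → V K) λ φ →
    IsBlockGraph K ×
    (∀ k → ∃ λ u → φ u ≡ k) ×
    (∀ k → ¬ IsCutVertex K k → ∀ u v → φ u ≡ k → φ v ≡ k → u ≡ v) ×
    (∀ u v → u ≢ v →
       (Adj B u v → (φ u ≡ φ v ⊎ Adj K (φ u) (φ v))) ×
       ((φ u ≡ φ v ⊎ Adj K (φ u) (φ v)) → Adj B u v))

IsInducedEmbedding : (B H : Graph) → (V B → V H) → Set
IsInducedEmbedding B H e =
  Injective _≡_ _≡_ e × (∀ u v → Graph.adj B u v ≡ Graph.adj H (e u) (e v))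

IsIsometricEmbedding : (H G : Graph) → (V H → V G) → Set
IsIsometricEmbedding H G f =
  IsInducedEmbedding H G f × (∀ u v k → Dist H u v k → Dist G (f u) (f v) k)

InNcx : (G : Graph) → V G → V G → V G → Set
InNcx G c x v = Adj G c v × (∃ λ k → Dist G c x (suc k) × Dist G v x k)

Vertebrate : Graph → Set
Vertebrate H =
  Connected H ×
  Σ Graph λ B → Σ (V B → V H) λ e →
    IsInducedEmbedding B H e × IsExtendedBlockGraph B ×
    (∀ (b : V B) (x : V H) k → Dist H (e b) x k → 2 ≤ k →
      Σ (V B) λ b' → InNcx H (e b) x (e b') ×
        (∀ v → InNcx H (e b) x v → ∀ w → ClosedNbr H v w → ClosedNbr H (e b') w))

-- The guarding game (one cop).
-- Time 0: cop at c 0, then robber at r 0.  Round t+1: cop moves to c (t+1)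
-- (knowing r 0 … r t), then robber moves to r (t+1).

CopStrategy : Graph → Set
CopStrategy G = V G × ((t : ℕ) → (Fin (suc t) → V G) → V G)

copPos : (G : Graph) → CopStrategy G → (ℕ → V G) → ℕ → V G
copPos G σ r zero    = proj₁ σ
copPos G σ r (suc t) = proj₂ σ t (λ i → r (toℕ i))

RobberWalk : (G : Graph) → (ℕ → V G) → Set
RobberWalk G r = ∀ t → ClosedNbr G (r t) (r (suc t))

LegalStrategy : (G : Graph) → CopStrategy G → Set
LegalStrategy G σ = ∀ r → RobberWalk G r → ∀ t →
  ClosedNbr G (copPos G σ r t) (copPos G σ r (suc t))

NotCaught : (G : Graph) → (ℕ → V G) → (ℕ → V G) → ℕ → Set
NotCaught G c r t = (∀ s → s ≤ t → c s ≢ r s) × (∀ s → s < t → c (suc s) ≢ r s)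

Guards : (G : Graph) → (V G → Set) → Set
Guards G InH = Σ (CopStrategy G) λ σ → LegalStrategy G σ ×
  (∀ r → RobberWalk G r → ∃ λ T → ∀ t → T ≤ t → NotCaught G (copPos G σ r) r t →
     InH (copPos G σ r t) × (InH (r t) → copPos G σ r (suc t) ≡ r t))

OneGuardable : Graph → Set
OneGuardable H = ∀ (G : Graph) → Connected G → ∀ (f : V H → V G) →
  IsIsometricEmbedding H G f → Guards G (λ v → ∃ λ x → f x ≡ v)

{-# OPTIONS --safe #-}

-- Measure the cop at c by its excess, the least n with d(c,x) ≤ d(r,x) + n for all x in H, where r is
-- the robber: once it is at most 1 on the cop's turn, every robber in H is adjacent to the cop.  The cop
-- moves to the vertex of the spine B that dominates N(c,x), where x attains the excess.  Since d(x,y) ≤ d(r,x) +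
-- d(r,y), a geodesic from x to any other critical y cannot pass around c, and along it the dominating
-- vertex of N(c,·) may be kept: for adjacent x, y at equal distance from c this holds because otherwise
-- the spine would contain a detour around c, which a block graph excludes.  So each move lowers the
-- excess, and the robber can at best restore it.  If the excess stays above 1, the same argument shows
-- that the cop never turns back, hence traces a local geodesic in the block graph, which cannot revisit
-- a vertex and is therefore bounded in length.

module Submission where

open import Defs
open import Data.Nat using (ℕ; zero; suc; _+_; _∸_; _≤_; _<_; z≤n; s≤s; s≤s⁻¹; _≤?_; _<?_)
open import Data.Nat.Properties hiding (_≟_)
open import Data.Nat.Induction using (<-wellFounded)
open import Induction.WellFounded using (Acc; acc)
open import Data.Fin using (Fin; toℕ; fromℕ; fromℕ<; inject₁)
open import Data.Fin.Properties using (_≟_; any?; all?; ¬∀⟶∃¬; pigeonhole; toℕ-inject₁; toℕ-fromℕ; toℕ<n)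
open import Data.Fin.Subset using (Subset; _∈_; _⊆_; ∣_∣)
open import Data.Fin.Subset.Properties using (_∈?_; p⊂q⇒∣p∣<∣q∣; ∣p∣≤n)
open import Data.Vec using (tabulate)
open import Data.Vec.Properties using (lookup∘tabulate; []=⇒lookup; lookup⇒[]=)
open import Data.Bool using (true)
import Data.Bool.Properties as Bool
open import Data.Maybe using (Maybe; just; nothing)
open import Data.Product using (Σ; ∃; _×_; _,_; proj₁; proj₂)
open import Data.Sum using (_⊎_; inj₁; inj₂)
open import Data.Empty using (⊥; ⊥-elim)
open import Data.Unit using (tt)
open import Function using (_∘_)
open import Relation.Nullary using (¬_; Dec; yes; no; does; contradiction)
open import Relation.Nullary.Decidable using (_×-dec_; _⊎-dec_; ¬?; dec-true; decidable-stable; map′)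
open import Relation.Unary using (Decidable)
open import Relation.Binary.Definitions using (tri<; tri≈; tri>)
open import Relation.Binary.PropositionalEquality

-- Least witnesses and decidable subsets

least : {Q : ℕ → Set} → Decidable Q → ∀ k → Q k →
        ∃ λ m → Q m × (∀ j → Q j → m ≤ j)
least Q? k q with Q? 0
... | yes q₀ = 0 , q₀ , λ _ _ → z≤n
least Q? zero    q | no ¬q₀ = contradiction q ¬q₀
least {Q} Q? (suc k) q | no ¬q₀ with least (Q? ∘ suc) k q
... | m , qm , min = suc m , qm , below
  where
  below : ∀ j → Q j → suc m ≤ j
  below zero    q₀ = contradiction q₀ ¬q₀
  below (suc j) qj = s≤s (min j qj)

separate : ∀ {n} {P : Fin n → Set} → Decidable P → Subset n
separate P? = tabulate (does ∘ P?)

separate⁺ : ∀ {n} {P : Fin n → Set} (P? : Decidable P) {x} → P x → x ∈ separate P?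
separate⁺ P? {x} px = lookup⇒[]= x _ (trans (lookup∘tabulate _ x) (dec-true (P? x) px))

separate⁻ : ∀ {n} {P : Fin n → Set} (P? : Decidable P) {x} → x ∈ separate P? → P x
separate⁻ P? {x} x∈ with P? x | trans (sym (lookup∘tabulate (does ∘ P?) x)) ([]=⇒lookup x∈)
... | yes px | _  = px
... | no _   | ()

-- Adjacency and walks

adj? : (G : Graph) → ∀ u v → Dec (Adj G u v)
adj? G u v = Graph.adj G u v Bool.≟ true

adj-symm : (G : Graph) → ∀ {u v} → Adj G u v → Adj G v u
adj-symm G {u} {v} uv = trans (sym (Graph.adj-sym G u v)) uv

adj⇒≢ : (G : Graph) → ∀ {u v} → Adj G u v → u ≢ v
adj⇒≢ G {u} uv refl with trans (sym uv) (Graph.adj-irrefl G u)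
... | ()

module Walks (G : Graph) where

  source : ∀ {P u v k} → WalkP G P u v k → P u
  source (here pu)     = pu
  source (step pu _ _) = pu

  target : ∀ {P u v k} → WalkP G P u v k → P v
  target (here pu)    = pu
  target (step _ _ w) = target w

  infixr 5 _++_
  _++_ : ∀ {P u v w k l} → WalkP G P u v k → WalkP G P v w l → WalkP G P u w (k + l)
  here _       ++ w′ = w′
  step pu uv w ++ w′ = step pu uv (w ++ w′)

  snoc : ∀ {P u v w k} → WalkP G P u v k → Adj G v w → P w → WalkP G P u w (suc k)
  snoc (here pu)      vw pw = step pu vw (here pw)
  snoc (step pu uv w) vw pw = step pu uv (snoc w vw pw)

  reverse : ∀ {P u v k} → WalkP G P u v k → WalkP G P v u k
  reverse (here pu)      = here pu
  reverse (step pu uv w) = snoc (reverse w) (adj-symm G uv) pu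

  walk? : ∀ {P} → Decidable P → ∀ u v k → Dec (WalkP G P u v k)
  walk? {P} P? u v zero = map′ (λ { (refl , pu) → here pu }) (λ { (here pu) → refl , pu })
                               (u ≟ v ×-dec P? u)
  walk? {P} P? u v (suc k) =
    map′ (λ { (pu , _ , uw , w) → step pu uw w }) (λ { (step pu uw w) → pu , _ , uw , w })
         (P? u ×-dec any? λ w → adj? G u w ×-dec walk? P? w v k)

module Interval (G : Graph) {P : V G → Set} where

  open Walks G

  -- A walk on towards b only meets vertices nearer to b than its start.
  onward : ∀ {Q : V G → Set} {a b p i j} →
           WalkP G P a p i → WalkP G P p b j → Q p →
           (∀ {q i′ j′} → WalkP G P a q i′ → WalkP G P q b j′ → i′ + j′ ≡ i + j → j′ < j → Q q) →
           ∃ λ l → WalkP G Q p b l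
  onward _ (here _) qp _ = 0 , here qp
  onward {i = i} u (step {k = j} pp pw w) qp later
    with onward (snoc u pw (source w)) w (later (snoc u pw (source w)) w (sym (+-suc i j)) ≤-refl)
                (λ u′ w′ eq lt → later u′ w′ (trans eq (sym (+-suc i j))) (m<n⇒m<1+n lt))
  ... | l , w′ = suc l , step qp pw w′

-- Biconnected sets and local geodesics in a block graph

module BlockGraph (K : Graph) (blocks : ∀ S → IsBlock K S → IsClique K S) where

  open Walks K
  open Interval K

  -- No block is computed. If `a` and `b` were apart, recursion on the number of vertices outside
  -- the set would refute every larger biconnected set, so `S` itself would be a block and hence a
  -- clique.
  biconnected-adjacent : ∀ S → ConnectedIn K S → NoCutIn K S →
                         ∀ {a b} → a ∈ S → b ∈ S → a ≡ b ⊎ Adj K a b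
  biconnected-adjacent S₀ conn₀ cut₀ {a} {b} a∈S₀ b∈S₀ =
    decidable-stable (a ≟ b ⊎-dec adj? K a b)
      λ apart → noBlock apart S₀ (<-wellFounded _) conn₀ cut₀ a∈S₀ b∈S₀
    where
    N = Graph.n K
    noBlock : ¬ (a ≡ b ⊎ Adj K a b) → ∀ S → Acc _<_ (N ∸ ∣ S ∣) → ConnectedIn K S → NoCutIn K S →
              a ∈ S → b ∈ S → ⊥
    noBlock apart S (acc rec) conn cut a∈S b∈S =
      apart (inj₂ (blocks S ((a , a∈S) , conn , cut , maximal) a b a∈S b∈S (apart ∘ inj₁)))
      where
      maximal : ∀ T → S ⊆ T → ConnectedIn K T → NoCutIn K T → T ⊆ S
      maximal T S⊆T connT cutT {x} x∈T with x ∈? S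
      ... | yes x∈S = x∈S
      ... | no x∉S  = ⊥-elim (noBlock apart T (rec smaller) connT cutT (S⊆T a∈S) (S⊆T b∈S))
        where
        smaller : N ∸ ∣ T ∣ < N ∸ ∣ S ∣
        smaller = ∸-monoʳ-< (p⊂q⇒∣p∣<∣q∣ (S⊆T , x , x∈T , x∉S)) (∣p∣≤n T)

  -- Together with v, the vertices lying on shortest a–b walks of K − v span a biconnected subgraph.
  neighbours-adjacent : ∀ {v a b l} → Adj K v a → Adj K v b → WalkP K (_≢ v) a b l →
                        a ≡ b ⊎ Adj K a b
  neighbours-adjacent {v} {a} {b} {l} va vb w₀
    with least (walk? (λ p → ¬? (p ≟ v)) a b) l w₀
  ... | m , w , shortest = biconnected-adjacent S connected noCut
        (mem (inj₂ (0 , z≤n , here (source w) , w)))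
        (mem (inj₂ (m , ≤-refl , w , subst (WalkP K (_≢ v) b b) (sym (n∸n≡0 m)) (here (target w)))))
    where
    W : V K → V K → ℕ → Set
    W = WalkP K (_≢ v)

    Mid : V K → Set
    Mid p = ∃ λ i → i ≤ m × W a p i × W p b (m ∸ i)

    member? : Decidable (λ p → p ≡ v ⊎ Mid p)
    member? p = p ≟ v ⊎-dec
      map′ (λ { (i , s≤s i≤m , r) → i , i≤m , r }) (λ { (i , i≤m , r) → i , s≤s i≤m , r })
           (anyUpTo? (λ i → walk? (λ p → ¬? (p ≟ v)) a p i ×-dec
                            walk? (λ p → ¬? (p ≟ v)) p b (m ∸ i)) (suc m))

    S : Subset (Graph.n K)
    S = separate member?

    mem : ∀ {p} → p ≡ v ⊎ Mid p → p ∈ S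
    mem = separate⁺ member?

    mid : ∀ {p i j} → W a p i → W p b j → i + j ≡ m → p ∈ S
    mid {p} {i} {j} u u′ refl =
      mem (inj₂ (i , m≤m+n i j , u , subst (W p b) (sym (m+n∸m≡n i j)) u′))

    join : ∀ {Q : V K → Set} {p q c} →
           ∃ (WalkP K Q p c) → ∃ (WalkP K Q q c) → ∃ (WalkP K Q p q)
    join (_ , u) (_ , u′) = _ , u ++ reverse u′

    connected : ConnectedIn K S
    connected p q p∈ q∈ = join (toB p∈) (toB q∈)
      where
      toB : ∀ {p} → p ∈ S → ∃ (WalkP K (_∈ S) p b)
      toB p∈ with separate⁻ member? p∈
      ... | inj₁ refl = _ , step p∈ vb (here (mid w (here (target w)) (+-identityʳ m)))
      ... | inj₂ (i , i≤m , u , u′) =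
        onward u u′ p∈ λ x x′ eq _ → mid x x′ (trans eq (m+[n∸m]≡n i≤m))

    noCut : NoCutIn K S
    noCut u u∈ p q (p∈ , p≢) (q∈ , q≢) with u ≟ v | separate⁻ member? u∈
    ... | yes refl | _ = join (toB p∈ p≢) (toB q∈ q≢)
      where
      toB : ∀ {p} → p ∈ S → p ≢ v → ∃ (WalkP K (λ x → x ∈ S × x ≢ v) p b)
      toB p∈ p≢ with separate⁻ member? p∈
      ... | inj₁ p≡v = contradiction p≡v p≢
      ... | inj₂ (i , i≤m , y , y′) =
        onward y y′ (p∈ , p≢) λ x x′ eq _ → mid x x′ (trans eq (m+[n∸m]≡n i≤m)) , source x′
    ... | no u≢v | inj₁ u≡v = contradiction u≡v u≢v
    ... | no u≢v | inj₂ (i , i≤m , au , ub) = join (toV p∈ p≢) (toV q∈ q≢)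
      where
      Q : V K → Set
      Q x = x ∈ S × x ≢ u
      v∈ : Q v
      v∈ = mem (inj₁ refl) , u≢v ∘ sym

      finish : ∀ {p x} → Adj K v x → ∃ (WalkP K Q p x) → ∃ (WalkP K Q p v)
      finish vx (_ , y) = _ , snoc y (adj-symm K vx) v∈

      toV : ∀ {p} → p ∈ S → p ≢ u → ∃ (WalkP K Q p v)
      toV {p} p∈ p≢ with separate⁻ member? p∈
      ... | inj₁ refl = 0 , here v∈
      -- From `p` the walk goes on to `b` if `p` is no farther from `b` than `u`, and back to `a`
      -- otherwise. It cannot meet `u`, since that would give an `a`-`b` walk shorter than `m`.
      ... | inj₂ (k , k≤m , ap , pb) with (m ∸ k) ≤? (m ∸ i)
      ...   | yes nearer = finish vb (onward ap pb (p∈ , p≢) λ {x} {i′} {j′} y y′ eq lt →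
                let eq′ = trans eq (m+[n∸m]≡n k≤m) in
                mid y y′ eq′ , λ { refl → <-irrefl refl
                  (≤-<-trans (shortest _ (au ++ y′))
                    (<-≤-trans (+-monoʳ-< i (<-≤-trans lt nearer)) (≤-reflexive (m+[n∸m]≡n i≤m)))) })
      ...   | no farther = finish va (onward (reverse pb) (reverse ap) (p∈ , p≢) λ {x} {i′} {j′} y y′ eq lt →
                let eq′ = trans (+-comm j′ i′) (trans eq (m∸n+n≡m k≤m)) in
                mid (reverse y′) (reverse y) eq′ , λ { refl → <-irrefl refl
                  (≤-<-trans (shortest _ (reverse y′ ++ ub))
                    (<-≤-trans (+-monoˡ-< (m ∸ i) (<-trans lt k<i)) (≤-reflexive (m+[n∸m]≡n i≤m)))) })
        where
        k<i : k < i
        k<i = ≰⇒> λ i≤k → farther (∸-monoʳ-≤ m i≤k)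

  -- A walk whose consecutive triples are geodesic never returns.
  noReturn : (s : ℕ → V K) (M : ℕ) →
             (∀ i → i < M → Adj K (s i) (s (suc i))) →
             (∀ i → suc i < M → ¬ (s i ≡ s (suc (suc i)) ⊎ Adj K (s i) (s (suc (suc i))))) →
             ∀ i l → suc (i + l) ≤ M → s i ≢ s (suc (i + l))
  noReturn s M edge bent i₀ l₀ = go l₀ (<-wellFounded l₀) i₀
    where
    go : ∀ l → Acc _<_ l → ∀ i → suc (i + l) ≤ M → s i ≢ s (suc (i + l))
    go zero _ i le eq = adj⇒≢ K (edge i (subst (_≤ M) (cong suc (+-identityʳ i)) le))
                          (trans eq (cong s (cong suc (+-identityʳ i))))
    go (suc l) (acc rec) i le eq rewrite +-suc i l =
      -- By induction the rest of the closed walk avoids `s (suc i)`, so it joins the two neighbours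
      -- of that vertex and makes them equal or adjacent.
      bent i (≤-trans (s≤s (s≤s (m≤m+n i l))) le)
        (neighbours-adjacent (adj-symm K (edge i i<M)) (edge (suc i) (≤-trans (s≤s (s≤s (m≤m+n i l))) le))
          (reverse (subst (λ x → WalkP K (_≢ s (suc i)) (s (suc (suc i))) x l) (sym eq) (tail l ≤-refl))))
      where
      i<M : i < M
      i<M = ≤-trans (s≤s (m≤n⇒m≤1+n (m≤m+n i l))) le
      avoid : ∀ k → k ≤ l → s (suc (suc (i + k))) ≢ s (suc i)
      avoid k k≤l = go k (rec (s≤s k≤l)) (suc i)
                       (≤-trans (s≤s (s≤s (+-monoʳ-≤ i k≤l))) le) ∘ sym
      tail : ∀ k → k ≤ l → WalkP K (_≢ s (suc i)) (s (suc (suc i))) (s (suc (suc (i + k)))) k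
      tail zero    k≤l rewrite +-identityʳ i =
        here (subst (λ z → s (suc (suc z)) ≢ s (suc i)) (+-identityʳ i) (avoid 0 k≤l))
      tail (suc k) k≤l = snoc (tail k (≤-trans (n≤1+n k) k≤l))
        (subst (λ z → Adj K (s (suc (suc (i + k)))) (s (suc (suc z)))) (sym (+-suc i k))
          (edge (suc (suc (i + k))) (≤-trans (s≤s (≤-trans (s≤s (≤-reflexive (sym (+-suc i k)))) (s≤s (+-monoʳ-≤ i k≤l)))) le)))
        (avoid (suc k) k≤l)

-- Distance and domination in a connected graph

module Metric (G : Graph) (conn : Connected G) where

  open Walks G

  private
    shortest : ∀ u v → ∃ λ k → Walk G u v k × (∀ j → Walk G u v j → k ≤ j)
    shortest u v with proj₂ conn u v tt tt
    ... | k , w = least (walk? (λ _ → yes tt) u v) k w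

  abstract
    d : V G → V G → ℕ
    d u v = proj₁ (shortest u v)

    d-walk : ∀ u v → Walk G u v (d u v)
    d-walk u v = proj₁ (proj₂ (shortest u v))

    d-least : ∀ {u v k} → Walk G u v k → d u v ≤ k
    d-least {u} {v} w = proj₂ (proj₂ (shortest u v)) _ w

  d-dist : ∀ u v → Dist G u v (d u v)
  d-dist u v = d-walk u v , λ _ → d-least

  dist⇒d : ∀ {u v k} → Dist G u v k → k ≡ d u v
  dist⇒d {u} {v} (w , min) = ≤-antisym (min _ (d-walk u v)) (d-least w)

  triangle : ∀ u v w → d u w ≤ d u v + d v w
  triangle u v w = d-least (d-walk u v ++ d-walk v w)

  d-sym : ∀ u v → d u v ≡ d v u
  d-sym u v = ≤-antisym (d-least (reverse (d-walk v u))) (d-least (reverse (d-walk u v)))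

  d-refl : ∀ u → d u u ≡ 0
  d-refl u = n≤0⇒n≡0 (d-least (here tt))

  d≡0⇒≡ : ∀ {u v} → d u v ≡ 0 → u ≡ v
  d≡0⇒≡ {u} {v} eq with d u v | d-walk u v
  d≡0⇒≡ refl | _ | here _ = refl

  near⇒closed : ∀ {u v} → d u v ≤ 1 → ClosedNbr G u v
  near⇒closed {u} {v} le with d u v | d-walk u v
  ... | _ | here _                = inj₁ refl
  ... | _ | step _ uv (here _)    = inj₂ uv
  near⇒closed (s≤s ()) | _ | step _ _ (step _ _ _)

  adj⇒near : ∀ {u v} → Adj G u v → d u v ≤ 1
  adj⇒near uv = d-least (step tt uv (here tt))

  closed⇒near : ∀ {u v} → ClosedNbr G u v → d u v ≤ 1
  closed⇒near {u} (inj₁ refl) = ≤-trans (≤-reflexive (d-refl u)) z≤n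
  closed⇒near (inj₂ uv) = adj⇒near uv

  near-sym : ∀ {u v} → d u v ≤ 1 → d v u ≤ 1
  near-sym {u} {v} = subst (_≤ 1) (d-sym u v)

  nearˡ : ∀ {u v} w → d u v ≤ 1 → d u w ≤ suc (d v w)
  nearˡ {u} {v} w uv = ≤-trans (triangle u v w) (+-monoˡ-≤ (d v w) uv)

  nearʳ : ∀ {v w} u → d v w ≤ 1 → d u w ≤ suc (d u v)
  nearʳ {v} {w} u vw = subst₂ _≤_ (d-sym w u) (cong suc (d-sym v u)) (nearˡ u (near-sym vw))

  towards : ∀ u v → 1 ≤ d u v → ∃ λ w → d u w ≤ 1 × d w v < d u v
  towards u v le with d u v | d-walk u v
  towards u v () | _ | here _
  ... | _ | step {w = w} _ uw r = w , adj⇒near uw , s≤s (d-least r)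

  Dominated : V G → V G → Set
  Dominated v a = ∀ w → d v w ≤ 1 → d a w ≤ 1

  -- From `a` the second vertex of a geodesic from `v` to `y` is within one move. The bound `1 ≤ L`
  -- covers `v = y`, where `a` may only be adjacent to `y`.
  dominated-closer : ∀ {v a y L} → Dominated v a → d v y ≤ L → 1 ≤ L → d a y ≤ L
  dominated-closer {v} {a} {y} dom vy 1≤L with 1 ≤? d v y
  ... | no ¬1≤ = ≤-trans (dom y (≤-trans (≤-pred (≰⇒> ¬1≤)) z≤n)) 1≤L
  ... | yes 1≤ with towards v y 1≤
  ...   | w , vw , wy = ≤-trans (nearˡ y (dom w vw)) (≤-trans wy vy)

  dominated-strictly : ∀ {v a y n} → Dominated v a → 2 ≤ n → d v y < n → d a y < n
  dominated-strictly dom (s≤s 1≤L) (s≤s vy) = s≤s (dominated-closer dom vy 1≤L)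

  -- This is N(c,x): the strict decrease rules out `v = c` and forces a drop of exactly one.
  Between : V G → V G → V G → Set
  Between c x v = d c v ≤ 1 × d v x < d c x

  between⇒InNcx : ∀ {c x v} → Between c x v → InNcx G c x v
  between⇒InNcx {c} {x} {v} (cv , vx) with near⇒closed {c} {v} cv
  ... | inj₁ refl = contradiction vx (<-irrefl refl)
  ... | inj₂ adj  = adj , d v x ,
        subst (Dist G c x) (≤-antisym (nearˡ x cv) vx) (d-dist c x) , d-dist v x

  inNcx⇒between : ∀ {c x v} → InNcx G c x v → Between c x v
  inNcx⇒between (cv , k , cx , vx) =
    adj⇒near cv , subst₂ _<_ (dist⇒d vx) (dist⇒d cx) ≤-refl

-- Dominating vertices of the spine

module Vertebrates
  (H : Graph) (connH : Connected H) (B : Graph) (e : V B → V H) (emb : IsInducedEmbedding B H e)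
  (K : Graph) (φ : V B → V K) (blocks : ∀ S → IsBlock K S → IsClique K S)
  (blowUp : ∀ u v → u ≢ v → (Adj B u v → (φ u ≡ φ v ⊎ Adj K (φ u) (φ v))) ×
                            ((φ u ≡ φ v ⊎ Adj K (φ u) (φ v)) → Adj B u v))
  (spine : ∀ (b : V B) (x : V H) k → Dist H (e b) x k → 2 ≤ k →
     Σ (V B) λ b′ → InNcx H (e b) x (e b′) ×
       (∀ v → InNcx H (e b) x v → ∀ w → ClosedNbr H v w → ClosedNbr H (e b′) w))
  where

  open Metric H connH
  open Walks K
  open BlockGraph K blocks

  Near : V K → V K → Set
  Near k l = k ≡ l ⊎ Adj K k l

  near⇒Near : ∀ {u v} → d (e u) (e v) ≤ 1 → Near (φ u) (φ v)
  near⇒Near {u} {v} le with u ≟ v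
  ... | yes refl = inj₁ refl
  ... | no u≢v with near⇒closed {e u} {e v} le
  ...   | inj₁ eq  = contradiction (sym (proj₁ emb eq)) u≢v
  ...   | inj₂ adj = proj₁ (blowUp u v u≢v) (trans (proj₂ emb u v) adj)

  Near⇒near : ∀ {u v} → Near (φ u) (φ v) → d (e u) (e v) ≤ 1
  Near⇒near {u} {v} nr with u ≟ v
  ... | yes refl = closed⇒near (inj₁ refl)
  ... | no u≢v   = adj⇒near (trans (sym (proj₂ emb u v)) (proj₂ (blowUp u v u≢v) nr))

  -- A relation rather than a chosen vertex, since one `a` is to serve several targets `x`.
  Good : V B → V H → V B → Set
  Good c x a = Between (e c) x (e a) × (∀ v → Between (e c) x v → Dominated v (e a))

  good : ∀ c x → 2 ≤ d (e c) x → ∃ (Good c x)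
  good c x le with spine c x _ (d-dist (e c) x) le
  ... | a , ca , dom = a , inNcx⇒between ca ,
        λ v cv w vw → closed⇒near (dom v (between⇒InNcx cv) w (near⇒closed vw))

  Shared : V B → V H → V H → Set
  Shared c x y = ∃ λ z → Between (e c) x z × Between (e c) y z

  shared? : ∀ c x y → Dec (Shared c x y)
  shared? c x y = any? λ z → (d (e c) z ≤? 1 ×-dec d z x <? d (e c) x) ×-dec
                             (d (e c) z ≤? 1 ×-dec d z y <? d (e c) y)

  -- As `a` dominates the shared vertex, it lies in N(c,y). So the vertex `b` chosen for `y`
  -- dominates `a` and lies in N(c,x); hence `a` dominates `b`, and with it all of N(c,y).
  share : ∀ {c x y a} → 2 ≤ d (e c) x → 2 ≤ d (e c) y → Shared c x y → Good c x a → Good c y a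
  share {c} {x} {y} {a} cx cy (z , (cz , zx) , (_ , zy)) ((ca , ax) , dom)
    with good c y cy
  ... | b , (cb , by) , dom-b = (ca , ay) , λ v vb w vw → a≥b w (dom-b v vb w vw)
    where
    ay : d (e a) y < d (e c) y
    ay = dominated-strictly (dom z (cz , zx)) cy zy
    a≥b : Dominated (e b) (e a)
    a≥b = dom (e b) (cb , dominated-strictly (dom-b (e a) (ca , ay)) cx ax)

  -- If `a` is no closer to `y` than `c`, then `b` and the second vertex `v` of a geodesic from `a`
  -- to `x` both lie in N(a,y). The vertex `u` dominating N(a,y) is close to `c` because of `b` and
  -- no farther from `x` than `a` because of `v`, so it is shared.
  shared-if-adjacent : ∀ {c x y a b} → d (e c) x ≡ d (e c) y → 2 ≤ d (e c) x → d x y ≤ 1 →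
                       Good c x a → Good c y b → d (e a) (e b) ≤ 1 → Shared c x y
  shared-if-adjacent {c} {x} {y} {a} {b} eq 2≤ xy ((ca , ax) , _) ((cb , by) , _) ab
    with d (e a) y <? d (e c) y
  ... | yes ay = e a , (ca , ax) , (ca , ay)
  ... | no far = e u , (cu , ux) , (cu , uy)
    where
    cy≤ay : d (e c) y ≤ d (e a) y
    cy≤ay = ≮⇒≥ far
    ay≤cx : d (e a) y ≤ d (e c) x
    ay≤cx = ≤-trans (nearʳ (e a) xy) ax
    1≤ax : 1 ≤ d (e a) x
    1≤ax = s≤s⁻¹ (≤-trans 2≤ (nearˡ x ca))
    best : ∃ (Good a y)
    best = good a y (≤-trans (subst (2 ≤_) eq 2≤) cy≤ay)
    u : V B
    u = proj₁ best
    dom : ∀ v → Between (e a) y v → Dominated v (e u)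
    dom = proj₂ (proj₂ best)
    next : ∃ λ v → d (e a) v ≤ 1 × d v x < d (e a) x
    next = towards (e a) x 1≤ax
    cu : d (e c) (e u) ≤ 1
    cu = near-sym (dom (e b) (ab , <-≤-trans by cy≤ay) (e c) (near-sym cb))
    uy : d (e u) y < d (e c) y
    uy = <-≤-trans (proj₂ (proj₁ (proj₂ best))) (≤-trans ay≤cx (≤-reflexive eq))
    ux : d (e u) x < d (e c) x
    ux with next
    ... | v , av , vx = ≤-trans (s≤s (dominated-closer
            (dom v (av , <-≤-trans (≤-<-trans (nearʳ v xy) (≤-<-trans vx ax)) (subst (_≤ d (e a) y) (sym eq) cy≤ay)))
            (<⇒≤ vx) 1≤ax)) ax

  -- Without a shared vertex, no vertex of B close to both x and y is a twin of c, so the spine leads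
  -- from a via x and y to b in K minus φ c; as K is a block graph, φ a and φ b are then adjacent.
  adjacent-unless-shared : ∀ {c x y a b} → d (e c) x ≡ d (e c) y → 2 ≤ d (e c) x → d x y ≤ 1 →
                           Good c x a → Good c y b → ¬ Shared c x y → d (e a) (e b) ≤ 1
  adjacent-unless-shared {c} {x} {y} {a} {b} eq 2≤ xy ((ca , ax) , _) ((cb , by) , _) ¬shared
    with φ a ≟ φ c | φ b ≟ φ c
  ... | yes ac | _ = Near⇒near (subst (λ k → Near k (φ b)) (sym ac) (near⇒Near cb))
  ... | no _   | yes bc = near-sym (Near⇒near (subst (λ k → Near k (φ a)) (sym bc) (near⇒Near ca)))
  ... | no ac  | no bc  = connect (descend _ ac ≤-refl ax) (descend _ bc ≤-refl by)
    where
    Linked : V B → V B → Set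
    Linked u v = ∃ (WalkP K (_≢ φ c) (φ u) (φ v))

    edge : ∀ {u v} → d (e u) (e v) ≤ 1 → φ u ≢ φ c → φ v ≢ φ c → Linked u v
    edge {u} {v} uv uc vc with near⇒Near uv
    ... | inj₁ eq  = 0 , subst (λ k → WalkP K (_≢ φ c) (φ u) k 0) eq (here uc)
    ... | inj₂ adj = 1 , step uc adj (here vc)

    -- Each new vertex is at least two closer to `x` than `c`, whereas a twin of `c` is at most one
    -- closer.
    descend : ∀ n {a x} → φ a ≢ φ c → d (e a) x ≤ n → n < d (e c) x → ∃ λ p → d (e p) x ≤ 1 × Linked a p
    descend n {a} {x} ac an nc with d (e a) x ≤? 1
    ... | yes le = a , le , 0 , here ac
    ... | no ¬le with good a x (≰⇒> ¬le)
    descend zero    ac an nc | no ¬le | _ = contradiction (≤-trans an z≤n) ¬le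
    descend (suc n) {a} {x} ac an nc | no _ | a′ , (aa′ , a′x) , _ =
      let p , px , k , w = descend n a′c (s≤s⁻¹ (≤-trans a′x an)) (<-trans (n<1+n n) nc)
          l , v = edge aa′ ac a′c
      in p , px , l + k , v ++ w
      where
      a′c : φ a′ ≢ φ c
      a′c eq′ = <⇒≱ nc (≤-trans (nearˡ x (Near⇒near (inj₁ (sym eq′)))) (≤-trans a′x an))

    untwinned : ∀ {v} → d (e v) x ≤ 1 → d (e v) y ≤ 1 → φ v ≢ φ c
    untwinned {v} vx vy eq′ = ¬shared (e v , (cv , ≤-trans (s≤s vx) 2≤) , (cv , ≤-trans (s≤s vy) (subst (2 ≤_) eq 2≤)))
      where
      cv : d (e c) (e v) ≤ 1
      cv = Near⇒near (inj₁ (sym eq′))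

    -- The targets serve as stepping stones: if `p` is far from `y`, then `x` lies in N(p,y), so the
    -- dominating vertex is close to both. In `meeting`, likewise, `y` lies in N(u,q).
    crossing : ∀ {p} → d (e p) x ≤ 1 → φ p ≢ φ c →
               ∃ λ u → d (e u) x ≤ 1 × d (e u) y ≤ 1 × Linked p u
    crossing {p} px pc with d (e p) y ≤? 1
    ... | yes py = p , px , py , 0 , here pc
    ... | no far with good p y (≰⇒> far)
    ...   | u , (pu , _) , dom = u , ux , uy , edge pu pc (untwinned ux uy)
      where
      ux : d (e u) x ≤ 1
      ux = dom x (px , ≤-<-trans xy (≰⇒> far)) x (closed⇒near (inj₁ refl))
      uy : d (e u) y ≤ 1
      uy = dom x (px , ≤-<-trans xy (≰⇒> far)) y xy

    meeting : ∀ {u q} → d (e u) x ≤ 1 → d (e u) y ≤ 1 → d (e q) y ≤ 1 → φ q ≢ φ c → Linked u q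
    meeting {u} {q} ux uy qy qc with d (e u) (e q) ≤? 1
    ... | yes uq = edge uq (untwinned ux uy) qc
    ... | no far with good u (e q) (≰⇒> far)
    ...   | w , (uw , _) , dom =
        let k , v = edge uw (untwinned ux uy) wc
            l , v′ = edge (at (e q) (near-sym qy)) wc qc
        in k + l , v ++ v′
      where
      at : Dominated y (e w)
      at = dom y (uy , ≤-<-trans (near-sym qy) (≰⇒> far))
      wc : φ w ≢ φ c
      wc = untwinned (at x (near-sym xy)) (at y (closed⇒near (inj₁ refl)))

    K-adj : ∀ {v} → d (e c) (e v) ≤ 1 → φ v ≢ φ c → Adj K (φ c) (φ v)
    K-adj cv vc with near⇒Near cv
    ... | inj₁ eq′ = contradiction (sym eq′) vc
    ... | inj₂ adj = adj

    connect : (∃ λ p → d (e p) x ≤ 1 × Linked a p) → (∃ λ q → d (e q) y ≤ 1 × Linked b q) →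
              d (e a) (e b) ≤ 1
    connect (p , px , _ , ap) (q , qy , _ , bq) with crossing px (target ap)
    ... | u , ux , uy , _ , pu with meeting ux uy qy (target bq)
    ...   | _ , uq = Near⇒near (neighbours-adjacent (K-adj ca ac) (K-adj cb bc)
                                 (ap ++ pu ++ uq ++ reverse bq))

  -- At different distances the vertex chosen for the nearer target is shared. At equal distances a
  -- failure of sharing would make `a` and `b` close, which produces a shared vertex after all.
  good-transfer : ∀ {c x y a} → 2 ≤ d (e c) x → 2 ≤ d (e c) y → d x y ≤ 1 → Good c x a → Good c y a
  good-transfer {c} {x} {y} {a} cx cy xy ga@((ca , ax) , _) = share cx cy shared ga
    where
    shared : Shared c x y
    shared with <-cmp (d (e c) x) (d (e c) y) | good c y cy
    ... | tri< lt _ _ | _ = e a , (ca , ax) , (ca , ≤-<-trans (≤-trans (nearʳ (e a) xy) ax) lt)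
    ... | tri> _ _ gt | b , (cb , by) , _ =
          e b , (cb , ≤-<-trans (≤-trans (nearʳ (e b) (near-sym xy)) by) gt) , (cb , by)
    ... | tri≈ _ eq _ | b , gb = decidable-stable (shared? c x y) λ ¬shared →
          ¬shared (shared-if-adjacent eq cx xy ga gb (adjacent-unless-shared eq cx xy ga gb ¬shared))

  -- While the walk keeps distance two from `c`, `a` stays good and so approaches `y` at the end. If
  -- the walk comes next to `c` at `z`, then `a` dominates `z`, and the length bound leaves at most
  -- `L` steps from `z` to `y`.
  follow : ∀ {c x y a m L} → Good c x a → 2 ≤ d (e c) x → Walk H x y m → suc m ≤ d (e c) x + L →
           1 ≤ L → d (e c) y ≤ suc L → d (e a) y ≤ L
  follow ((_ , ax) , _) _ (here _) _ _ cy = s≤s⁻¹ (≤-trans ax cy)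
  follow {c} {x} {y} {L = L} ga@(_ , dom) cx (step {w = z} {k = m} _ xz w) le 1≤L cy with 2 ≤? d (e c) z
  ... | yes cz = follow (good-transfer cx cz (adj⇒near xz) ga) cz w
                   (s≤s⁻¹ (≤-trans le (+-monoˡ-≤ L (nearʳ (e c) (near-sym (adj⇒near xz)))))) 1≤L cy
  ... | no ¬cz = dominated-closer (dom z (cz≤1 , ≤-trans (s≤s (near-sym (adj⇒near xz))) cx))
                   (≤-trans (d-least w) m≤L) 1≤L
    where
    cz≤1 : d (e c) z ≤ 1
    cz≤1 = s≤s⁻¹ (≰⇒> ¬cz)
    m≤L : m ≤ L
    m≤L = s≤s⁻¹ (s≤s⁻¹ (≤-trans le (+-monoˡ-≤ L (≤-trans (nearʳ (e c) (near-sym (adj⇒near xz))) (s≤s cz≤1)))))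

  -- A single move of the cop

  -- D x stands for the distance from the robber to x.
  module Pursuit where

    Within : (V H → ℕ) → V B → ℕ → Set
    Within D c n = ∀ x → d (e c) x ≤ D x + n

    within? : ∀ D c n → Dec (Within D c n)
    within? D c n = all? λ x → d (e c) x ≤? D x + n

    within-mono : ∀ {D c m n} → m ≤ n → Within D c m → Within D c n
    within-mono {D} m≤n wm x = ≤-trans (wm x) (+-monoʳ-≤ (D x) m≤n)

    -- The triangle inequality through the robber's position, which may lie outside `H`.
    DistanceLike : (V H → ℕ) → Set
    DistanceLike D = ∀ x y → d x y ≤ D x + D y

    Tight : (V H → ℕ) → V B → V B → ℕ → Set
    Tight D c c′ n = ∃ λ x → d (e c) x ≡ D x + n × Good c x c′

    -- Quantifying over every bound `n` avoids storing the excess in the game; `tight` keeps the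
    -- witness that later excludes backtracking.
    record Move (D : V H → ℕ) (c : V B) : Set where
      field
        to      : V B
        near    : d (e c) (e to) ≤ 1
        gain    : ∀ n → Within D c (suc n) → Within D to n
        tight   : ∀ n → Within D c (suc n) → ¬ Within D c n → Tight D c to (suc n)

    move : ∀ D c → DistanceLike D → (∀ x → D x ≡ 0 → d (e c) x ≢ 1) → Move D c
    move D c dist free with least (within? D c) (D (e c)) (λ x → ≤-trans (dist (e c) x) (≤-reflexive (+-comm (D (e c)) (D x))))
    ... | zero , w , _ = record
      { to = c ; near = closed⇒near (inj₁ refl) ; gain = λ n _ → within-mono z≤n w
      ; tight = λ n _ ¬w → contradiction (within-mono z≤n w) ¬w }
    ... | suc n , w , min = record
      { to = a ; near = proj₁ (proj₁ ga)
      ; gain = λ m wm → within-mono (s≤s⁻¹ (min _ wm)) closer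
      ; tight = tight′ }
      where
      far : ∃ λ x → ¬ (d (e c) x ≤ D x + n)
      far = ¬∀⟶∃¬ _ _ (λ x → d (e c) x ≤? D x + n) λ wn → <-irrefl refl (min n wn)
      x : V H
      x = proj₁ far
      cx : d (e c) x ≡ D x + suc n
      cx = ≤-antisym (w x) (≤-trans (≤-reflexive (+-suc (D x) n)) (≰⇒> (proj₂ far)))
      cx≢1 : d (e c) x ≢ 1
      cx≢1 eq = free x (m+n≡0⇒m≡0 (D x) (suc-injective (trans (sym (+-suc (D x) n)) (trans (sym cx) eq)))) eq
      2≤cx : 2 ≤ d (e c) x
      2≤cx = ≤∧≢⇒< (≤-trans (s≤s z≤n) (≤-reflexive (sym (trans cx (+-suc (D x) n))))) (cx≢1 ∘ sym)
      a : V B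
      a = proj₁ (good c x 2≤cx)
      ga : Good c x a
      ga = proj₂ (good c x 2≤cx)
      -- If `D y + n` were 0, the robber would stand on `y`, within one of `c`, hence on `c` itself
      -- by `free`. Then `d (e c) x ≤ D x`, against the choice of `x`.
      1≤ : ∀ y → 1 ≤ D y + n
      1≤ y with 1 ≤? D y + n
      ... | yes le = le
      ... | no ¬le = contradiction y≡c y≢c
        where
        Dy+n≡0 : D y + n ≡ 0
        Dy+n≡0 = n≤0⇒n≡0 (s≤s⁻¹ (≰⇒> ¬le))
        Dy≡0 : D y ≡ 0
        Dy≡0 = m+n≡0⇒m≡0 (D y) Dy+n≡0
        cy≤1 : d (e c) y ≤ 1
        cy≤1 = ≤-trans (w y) (≤-reflexive (trans (+-suc (D y) n) (cong suc Dy+n≡0)))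
        y≡c : e c ≡ y
        y≡c = d≡0⇒≡ (n≤0⇒n≡0 (s≤s⁻¹ (≤∧≢⇒< cy≤1 (free y Dy≡0))))
        y≢c : e c ≢ y
        y≢c refl = <⇒≱ (m<m+n (D x) (s≤s z≤n)) (≤-trans (≤-reflexive (sym cx))
                     (≤-trans (dist (e c) x) (≤-reflexive (cong (_+ D x) Dy≡0))))
      closer : Within D a n
      -- Since `D x < d (e c) x`, the bound `D x + D y` on the geodesic from `x` to `y` makes it
      -- short enough for `follow`.
      closer y = follow ga 2≤cx (d-walk x y)
        (≤-trans (s≤s (dist x y)) (≤-trans (≤-reflexive (+-assoc 1 (D x) (D y)))
          (+-mono-≤ 1+Dx≤cx (m≤m+n (D y) n))))
        (1≤ y) (≤-trans (w y) (≤-reflexive (+-suc (D y) n)))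
        where
        1+Dx≤cx : suc (D x) ≤ d (e c) x
        1+Dx≤cx = ≤-trans (m<m+n (D x) (s≤s z≤n)) (≤-reflexive (sym cx))
      tight′ : ∀ m → Within D c (suc m) → ¬ Within D c m → Tight D c a (suc m)
      tight′ m wm ¬wm with ≤-antisym (min _ wm) (≰⇒> λ 1+n≤m → ¬wm (within-mono 1+n≤m w))
      ... | refl = x , cx , ga

    -- By `follow` from `y` to `x`, the second move also approaches the first witness `x`. Then `c″`
    -- is at least two closer to `x` than `c`, so the two cannot be close.
    noBacktrack : ∀ {D D′ c c′ c″ n} → DistanceLike D → (∀ x → D x ≤ suc (D′ x)) →
                  Tight D c c′ (suc (suc n)) → Tight D′ c′ c″ (suc (suc n)) → ¬ (d (e c) (e c″) ≤ 1)
    noBacktrack {D} {D′} {c} {c′} {c″} {n} dist slow (x , cx , g@((cc′ , c′x) , dom)) (y , c′y , g′@((c′c″ , c″y) , dom′)) cc″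
      with 1 ≤? D x + n
    ... | yes 1≤ = <⇒≱ (≤-reflexive (sym cx′)) (nearˡ-below (follow g′ 2≤c′y (d-walk y x) short 1≤ c′x≤))
      where
      cx′ : d (e c) x ≡ suc (suc (D x + n))
      cx′ = trans cx (trans (+-suc (D x) (suc n)) (cong suc (+-suc (D x) n)))
      c′x≤ : d (e c′) x ≤ suc (D x + n)
      c′x≤ = s≤s⁻¹ (≤-trans c′x (≤-reflexive cx′))
      2≤c′y : 2 ≤ d (e c′) y
      2≤c′y = ≤-trans (s≤s (s≤s z≤n)) (≤-trans (m≤n+m (suc (suc n)) (D′ y)) (≤-reflexive (sym c′y)))
      nearˡ-below : d (e c″) x ≤ D x + n → d (e c) x ≤ suc (D x + n)
      nearˡ-below le = ≤-trans (nearˡ x cc″) (s≤s le)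
      short : suc (d y x) ≤ d (e c′) y + (D x + n)
      short = ≤-trans (s≤s (≤-trans (dist y x) (+-monoˡ-≤ (D x) (slow y))))
        (+-mono-≤ (≤-trans (≤-reflexive (+-comm 2 (D′ y)))
          (≤-trans (+-monoʳ-≤ (D′ y) (s≤s (s≤s z≤n))) (≤-reflexive (sym c′y)))) (m≤m+n (D x) n))
    -- Now `d (e c) x` is 2 and `follow` would need the bound 0. Instead `x` lies in N(c′,y), so
    -- `c″` dominates it; if close to `c`, `c″` would lie in N(c,x) and be dominated by `c′`, making
    -- `c′` closer to `y` than itself.
    ... | no ¬1≤ = <-irrefl refl (dominated-strictly
                     (dom (e c″) (cc″ , ≤-<-trans c″x (≤-reflexive (sym cx≡2)))) 2≤c′y c″y)
      where
      Dx+n≡0 : D x + n ≡ 0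
      Dx+n≡0 = n≤0⇒n≡0 (s≤s⁻¹ (≰⇒> ¬1≤))
      cx≡2 : d (e c) x ≡ 2
      cx≡2 = trans cx (trans (+-suc (D x) (suc n)) (cong suc (trans (+-suc (D x) n) (cong suc Dx+n≡0))))
      2≤c′y : 2 ≤ d (e c′) y
      2≤c′y = ≤-trans (s≤s (s≤s z≤n)) (≤-trans (m≤n+m (suc (suc n)) (D′ y)) (≤-reflexive (sym c′y)))
      xy : d x y < d (e c′) y
      xy = ≤-<-trans (≤-trans (dist x y) (+-mono-≤ (≤-reflexive (m+n≡0⇒m≡0 (D x) Dx+n≡0)) (slow y)))
             (≤-trans (≤-reflexive (+-comm 2 (D′ y))) (≤-trans (+-monoʳ-≤ (D′ y) (s≤s (s≤s z≤n)))
               (≤-reflexive (sym c′y))))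
      c″x : d (e c″) x ≤ 1
      c″x = dom′ x (s≤s⁻¹ (≤-trans c′x (≤-reflexive cx≡2)) , xy) x (closed⇒near (inj₁ refl))

  -- The strategy in the host graph

  module Guarding (G : Graph) (connG : Connected G) (f : V H → V G)
                  (iso : IsIsometricEmbedding H G f) (b₀ : V B) where

    open Pursuit
    module M = Metric G connG

    D : V G → V H → ℕ
    D r x = M.d r (f x)

    -- Isometry carries the distance of `H` over to `G`, where the robber lives.
    distanceLike : ∀ r → DistanceLike (D r)
    distanceLike r x y = ≤-trans
      (≤-reflexive (M.dist⇒d (proj₂ iso x y _ (d-dist x y))))
      (≤-trans (M.triangle (f x) r (f y)) (+-monoˡ-≤ _ (≤-reflexive (M.d-sym (f x) r))))

    f-adj : ∀ {x y} → Adj H x y → Adj G (f x) (f y)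
    f-adj {x} {y} = trans (sym (proj₂ (proj₁ iso) x y))

    Threat : V B → V G → Set
    Threat c r = Adj G (f (e c)) r

    unthreatened : ∀ {c r} → ¬ Threat c r → ∀ x → D r x ≡ 0 → d (e c) x ≢ 1
    unthreatened {c} ¬threat x eq eq₁ with M.d≡0⇒≡ eq | near⇒closed {e c} {x} (≤-reflexive eq₁)
    ... | refl | inj₁ refl = 0≢1+n (trans (sym (d-refl x)) eq₁)
    ... | refl | inj₂ adj  = ¬threat (f-adj adj)

    advance : ∀ c r → Σ (V B) λ c′ → d (e c) (e c′) ≤ 1 ×
                        (¬ Threat c r → Σ (Move (D r) c) λ mv → Move.to mv ≡ c′)
    advance c r with adj? G (f (e c)) r
    -- A default: a capture is made by `latch`, so the spine vertex may rest.
    ... | yes threat = c , closed⇒near (inj₁ refl) , contradiction threat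
    ... | no ¬threat = Move.to mv , Move.near mv , λ _ → mv , refl
      where
      mv : Move (D r) c
      mv = move (D r) c (distanceLike r) (unthreatened ¬threat)

    -- The first component keeps moving in B even after a capture; the second, once set, is where it happened.
    State : Set
    State = V B × Maybe (V G)

    place : State → V G
    place (c , nothing) = f (e c)
    place (_ , just g)  = g

    latch : V B → Maybe (V G) → V G → Maybe (V G)
    latch c (just g) r = just g
    latch c nothing  r with adj? G (f (e c)) r
    ... | yes _ = just r
    ... | no _  = nothing

    next : State → V G → State
    next (c , m) r = proj₁ (advance c r) , latch c m r

    advance-legal : ∀ c r → ClosedNbr G (f (e c)) (f (e (proj₁ (advance c r))))
    advance-legal c r with near⇒closed (proj₁ (proj₂ (advance c r)))
    ... | inj₁ eq  = inj₁ (cong f eq)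
    ... | inj₂ adj = inj₂ (f-adj adj)

    next-legal : ∀ s r → ClosedNbr G (place s) (place (next s r))
    next-legal (c , just g)  r = inj₁ refl
    next-legal (c , nothing) r with adj? G (f (e c)) r | advance-legal c r
    ... | yes threat | _     = inj₂ threat
    ... | no _       | legal = legal

    -- A strategy sees only the robber's history, so the state is recomputed from it.
    replay : ∀ t → (Fin t → V G) → State
    replay zero    h = b₀ , nothing
    replay (suc t) h = next (replay t (h ∘ inject₁)) (h (fromℕ t))

    strategy : CopStrategy G
    strategy = f (e b₀) , λ t h → place (replay (suc t) h)

    -- Play against a fixed robber

    module Play (r : ℕ → V G) where

      state : ℕ → State
      state zero    = b₀ , nothing
      state (suc t) = next (state t) (r t)

      replay≡state : ∀ t (h : Fin t → V G) → (∀ i → h i ≡ r (toℕ i)) → replay t h ≡ state t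
      replay≡state zero    h eq = refl
      replay≡state (suc t) h eq = cong₂ next
        (replay≡state t (h ∘ inject₁) λ i → trans (eq (inject₁ i)) (cong r (toℕ-inject₁ i)))
        (trans (eq (fromℕ t)) (cong r (toℕ-fromℕ t)))

      copPos≡place : ∀ t → copPos G strategy r t ≡ place (state t)
      copPos≡place zero    = refl
      copPos≡place (suc t) = cong place (replay≡state (suc t) _ λ _ → refl)

      legal : ∀ t → ClosedNbr G (copPos G strategy r t) (copPos G strategy r (suc t))
      legal t = subst₂ (ClosedNbr G) (sym (copPos≡place t)) (sym (copPos≡place (suc t)))
                       (next-legal (state t) (r t))

      b : ℕ → V B
      b t = proj₁ (state t)

      capture : ∀ s → proj₂ (state s) ≡ nothing → Threat (b s) (r s) → place (state (suc s)) ≡ r s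
      capture s eq threat rewrite eq with adj? G (f (e (b s))) (r s)
      ... | yes _ = refl
      ... | no ¬threat = contradiction threat ¬threat

      stay-unlatched : ∀ s → proj₂ (state s) ≡ nothing → ¬ Threat (b s) (r s) →
                       proj₂ (state (suc s)) ≡ nothing
      stay-unlatched s eq ¬threat rewrite eq with adj? G (f (e (b s))) (r s)
      ... | yes threat = contradiction threat ¬threat
      ... | no _       = refl

      Alive : ℕ → Set
      Alive t = ∀ s → s < t → ¬ Threat (b s) (r s)

      alive-mono : ∀ {s t} → s ≤ t → Alive t → Alive s
      alive-mono s≤t al u u<s = al u (<-≤-trans u<s s≤t)

      NC : ℕ → Set
      NC = NotCaught G (copPos G strategy r) r

      -- The latch is set only by a move onto the robber, which the second half of `NotCaught`
      -- excludes.
      unlatched : ∀ {t} → NC t → ∀ s → s ≤ t → proj₂ (state s) ≡ nothing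
      unlatched nc zero    _   = refl
      unlatched nc (suc s) s<t = stay-unlatched s eq λ threat →
        proj₂ nc s s<t (trans (copPos≡place (suc s)) (capture s eq threat))
        where
        eq : proj₂ (state s) ≡ nothing
        eq = unlatched nc s (<⇒≤ s<t)

      alive : ∀ {t} → NC t → Alive t
      alive nc s s<t threat = proj₂ nc s s<t
        (trans (copPos≡place (suc s)) (capture s (unlatched nc s (<⇒≤ s<t)) threat))

      spinePlace : ∀ {t} → NC t → copPos G strategy r t ≡ f (e (b t))
      spinePlace {t} nc = trans (copPos≡place t) (cong (λ m → place (b t , m)) (unlatched nc t ≤-refl))

      stepNear : ∀ s → d (e (b s)) (e (b (suc s))) ≤ 1
      stepNear s = proj₁ (proj₂ (advance (b s) (r s)))

      Excess : ℕ → ℕ → Set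
      Excess t = Within (D (r t)) (b t)

      gainAt : ∀ s → ¬ Threat (b s) (r s) → ∀ n → Excess s (suc n) → Within (D (r s)) (b (suc s)) n
      gainAt s ¬threat n w with proj₂ (proj₂ (advance (b s) (r s))) ¬threat
      ... | mv , eq = subst (λ c → Within (D (r s)) c n) eq (Move.gain mv n w)

      tightAt : ∀ s → ¬ Threat (b s) (r s) → ∀ n → Excess s (suc n) → ¬ Excess s n →
                Tight (D (r s)) (b s) (b (suc s)) (suc n)
      tightAt s ¬threat n w ¬w with proj₂ (proj₂ (advance (b s) (r s))) ¬threat
      ... | mv , eq = subst (λ c → Tight (D (r s)) (b s) c (suc n)) eq (Move.tight mv n w ¬w)

      -- Decrease of the excess

      module _ (walk : RobberWalk G r) where

        slow : ∀ s x → D (r s) x ≤ suc (D (r (suc s)) x)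
        slow s x = M.nearˡ (f x) (M.closed⇒near (walk s))

        -- The cop's move lowers the bound by one and the robber's answer raises it by at most one.
        keep : ∀ k {t n} → Alive (k + t) → Excess t (suc n) → Excess (k + t) (suc n)
        keep zero    al w = w
        keep (suc k) {t} {n} al w x = ≤-trans
          (gainAt (k + t) (al (k + t) ≤-refl) n (keep k (alive-mono (n≤1+n _) al) w) x)
          (≤-trans (+-monoˡ-≤ n (slow (k + t) x)) (≤-reflexive (sym (+-suc _ n))))

        W : ℕ
        W = suc (Graph.n K)

        -- As long as the excess stays put, the cop's trace in K is a local geodesic.
        window : ∀ t n → Alive (W + t) → Excess t (suc (suc n)) → Excess (W + t) (suc n)
        window t n al w = decidable-stable (within? (D (r (W + t))) (b (W + t)) (suc n)) stuck
          where
          stuck : ¬ ¬ Excess (W + t) (suc n)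
          stuck ¬w = collision (pigeonhole ≤-refl (λ (i : Fin W) → s (toℕ i)))
            where
            s : ℕ → V K
            s i = φ (b (i + t))
            upto : ∀ {i} → i ≤ W → Alive (i + t)
            upto i≤W = alive-mono (+-monoˡ-≤ t i≤W) al
            -- By `keep`, a drop inside the window would last until its end; so there is none, and
            -- every move is tight.
            still : ∀ i → i ≤ W → ¬ Excess (i + t) (suc n)
            still i i≤W wi = ¬w (subst (λ z → Excess z (suc n)) eq
                                   (keep (W ∸ i) (subst Alive (sym eq) al) wi))
              where
              eq : (W ∸ i) + (i + t) ≡ W + t
              eq = trans (sym (+-assoc (W ∸ i) i t)) (cong (_+ t) (m∸n+n≡m i≤W))
            tightStep : ∀ i → i < W → Tight (D (r (i + t))) (b (i + t)) (b (suc i + t)) (suc (suc n))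
            tightStep i i<W = tightAt (i + t) (al (i + t) (+-monoˡ-< t i<W)) (suc n)
                                (keep i (upto (<⇒≤ i<W)) w) (still i (<⇒≤ i<W))
            apart : ∀ i → suc i < W → ¬ Near (s i) (s (suc (suc i)))
            apart i lt = noBacktrack (distanceLike (r (i + t))) (slow (i + t))
                           (tightStep i (<⇒≤ lt)) (tightStep (suc i) lt) ∘ Near⇒near
            -- A move between twins would leave the ends of two successive moves close, against
            -- `apart`. This needs a following move, so the last one of the window is left out.
            edge : ∀ i → suc i < W → Adj K (s i) (s (suc i))
            edge i lt with near⇒Near (stepNear (i + t))
            ... | inj₂ adj = adj
            ... | inj₁ eq  = contradiction
                  (subst (λ k → Near k (s (suc (suc i)))) (sym eq) (near⇒Near (stepNear (suc i + t))))
                  (apart i lt)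
            collision : (∃ λ i → ∃ λ j → toℕ i < toℕ j × s (toℕ i) ≡ s (toℕ j)) → ⊥
            collision (i , j , i<j , eq) =
              noReturn s (Graph.n K) (λ i lt → edge i (s≤s lt)) (λ i lt → apart i (<⇒≤ (s≤s lt)))
                (toℕ i) (toℕ j ∸ suc (toℕ i))
                (≤-trans (≤-reflexive (m+[n∸m]≡n i<j)) (s≤s⁻¹ (toℕ<n j)))
                (trans eq (cong s (sym (m+[n∸m]≡n i<j))))

        deadline : ℕ → ℕ → ℕ
        deadline zero    t = t
        deadline (suc N) t = deadline N (W + t)

        deadline-≥ : ∀ N t → t ≤ deadline N t
        deadline-≥ zero    t = ≤-refl
        deadline-≥ (suc N) t = ≤-trans (m≤n+m t W) (deadline-≥ N (W + t))

        settle : ∀ N t → Alive (deadline N t) → Excess t (suc N) → Excess (deadline N t) 1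
        settle zero    t al w = w
        settle (suc N) t al w = settle N (W + t) al (window t N (alive-mono (deadline-≥ N (W + t)) al) w)

        -- The initial excess is at most `D (r 0) (e b₀)` by the triangle inequality, and each
        -- window lowers the bound by one.
        T : ℕ
        T = deadline (D (r 0) (e b₀)) 0

        settled : ∀ t → T ≤ t → NC t → Excess t 1
        settled t T≤t nc = subst (λ z → Excess z 1) eq
          (keep (t ∸ T) (subst Alive (sym eq) (alive nc))
            (settle _ 0 (alive-mono T≤t (alive nc)) initial))
          where
          eq : t ∸ T + T ≡ t
          eq = m∸n+n≡m T≤t
          initial : Excess 0 (suc (D (r 0) (e b₀)))
          initial x = ≤-trans (distanceLike (r 0) (e b₀) x)
            (≤-trans (≤-reflexive (+-comm (D (r 0) (e b₀)) _)) (+-monoʳ-≤ _ (n≤1+n _)))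

        -- A robber on `x` in `H` has distance 0 to `x`, so excess at most 1 puts it within one of
        -- the cop; being uncaught, it is adjacent.
        respond : ∀ t → T ≤ t → NC t → (∃ λ x → f x ≡ r t) → copPos G strategy r (suc t) ≡ r t
        respond t T≤t nc (x , fx) = trans (copPos≡place (suc t)) (capture t (unlatched nc t ≤-refl) threat)
          where
          close : d (e (b t)) x ≤ 1
          close = ≤-trans (settled t T≤t nc x) (≤-reflexive
                    (cong (_+ 1) (trans (cong (λ z → M.d z (f x)) (sym fx)) (M.d-refl (f x)))))
          threat : Threat (b t) (r t)
          threat with near⇒closed close
          ... | inj₁ eq  = contradiction (trans (spinePlace nc) (trans (cong f (sym eq)) fx)) (proj₁ nc t ≤-refl)
          ... | inj₂ adj = subst (Adj G _) fx (f-adj adj)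

    guards : Guards G (λ v → ∃ λ x → f x ≡ v)
    guards = strategy , (λ r _ → Play.legal r) , λ r walk → let open Play r in
      T walk , λ t T≤t nc → (e (b t) , sym (spinePlace nc)) , respond walk t T≤t nc

theorem8 : ∀ (H : Graph) → Vertebrate H → OneGuardable H
theorem8 H (connH , B , e , emb , (K , φ , (connK , blocks) , onto , _ , blowUp) , spine) G connG f iso =
  Vertebrates.Guarding.guards H connH B e emb K φ blocks blowUp spine G connG f iso
    -- The cop starts at a preimage of some vertex of the nonempty graph `K`.
    (proj₁ (onto (fromℕ< (proj₁ connK))))
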